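{- The meta-logic $\mathcal{M}_{\mathrm{IFOL}}$ is complete for intuitionistic first-order logic (IFOL). That is, for all IFOL formulae $A_1,\ldots,A_m,B$: for every IFOL-proof of $B$ from $A_1,\ldots,A_m$, there is an $\mathcal{M}_{\mathrm{IFOL}}$-proof of $[\![B]\!]$ from $[\![A_1]\!],\ldots,[\![A_m]\!]$.
   Context: **The meta-logic $\mathcal{M}$** (a fragment of intuitionistic higher-order logic). Types: basic types, including the type $prop$ of propositions, and function types $\sigma\to\tau$. Terms: those of the simply typed $\lambda$-calculus (constants, variables, abstractions, applications; variables of every type are available); $a(b_1,\ldots,b_k)$ means $(\cdots(a\,b_1)\cdots b_k)$. A (meta-)formula is a term of type $prop$. Logical constants, for every type $\sigma$: $\Rightarrow\;: prop\to(prop\to prop)$, $\bigwedge_\sigma : (\sigma\to prop)\to prop$, $\equiv_\sigma : \sigma\to(\sigma\to prop)$. One writes $\bigwedge x.\phi$ for $\bigwedge_\sigma(\lambda x.\phi)$ with $x:\sigma$; $\Rightarrow$ associates to the right; the scope of a binder extends as far right as possible; $\phi[b/x]$ is capture-avoiding substitution. Inference rules of $\mathcal{M}$ (natural deduction; $\phi,\psi$ are formulae; "assumptions" means the undischarged assumptions on which the premise depends): - $\Rightarrow$-introduction: from a proof of $\psi$ from assumption $\phi$, infer $\phi\Rightarrow\psi$, discharging $\phi$. $\Rightarrow$-elimination: from $\phi\Rightarrow\psi$ and $\phi$ infer $\psi$. - $\bigwedge$-introduction: from $\phi$ infer $\bigwedge x.\phi$, provided $x$ is not free in the assumptions. $\bigwedge$-elimination: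 from $\bigwedge x.\phi$ infer $\phi[b/x]$, for any term $b$ of the type of $x$. - Equality: $a\equiv a$; from $a\equiv b$ infer $b\equiv a$; from $a\equiv b$ and $b\equiv c$ infer $a\equiv c$. - $\lambda$-conversions: $(\lambda x.a)\equiv(\lambda y.a[y/x])$ if $y$ is not free in $a$; $((\lambda x.a)(b))\equiv a[b/x]$; extensionality: from $f(x)\equiv g(x)$ infer $f\equiv g$, if $x$ is not free in the assumptions, $f$, or $g$. - Abstraction: from $a\equiv b$ infer $(\lambda x.a)\equiv(\lambda x.b)$, if $x$ is not free in the assumptions. Combination: from $f\equiv g$ and $a\equiv b$ infer $f(a)\equiv g(b)$. - Logical equivalence: from a proof of $\psi$ from assumption $\phi$ and a proof of $\phi$ from assumption $\psi$, infer $\phi\equiv\psi$, discharging these assumptions; from $\phi\equiv\psi$ and $\phi$ infer $\psi$. **The object-logic IFOL.** Fix a first-order signature of function and predicate symbols. Terms are built from individual variables and function symbols; formulae are built from atomic formulae (predicate symbols applied to terms, and propositional variables) and $\bot$ by $\&,\vee,\supset$ and the quantifiers $\forall x.A$, $\exists x.A$. The natural deduction rules are: - $\&$I: from $A$ and $B$ infer $A\,\&\,B$. $\&$E: from $A\,\&\,B$ infer $A$; from $A\,\&\,B$ infer $B$. - $\vee$I: from $A$ infer $A\vee B$; from $B$ infer $A\vee B$. $\vee$E: from $A\vee B$, a proof of $C$ from assumption $A$, and a proof of $C$ from assumption $B$, infer $C$, discharging these assumptions. - $\supset$I: from a proof of $B$ from assumption $A$ infer $A\supset B$, discharging $A$.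 $\supset$E: from $A\supset B$ and $A$ infer $B$. - $\bot$E: from $\bot$ infer $A$. - $\forall$I: from $A$ infer $\forall x.A$, provided $x$ is not free in the assumptions. $\forall$E: from $\forall x.A$ infer $A[t/x]$, for any term $t$. - $\exists$I: from $A[t/x]$ infer $\exists x.A$. $\exists$E: from $\exists x.A$ and a proof of $B$ from assumption $A$, infer $B$, discharging $A$, provided $x$ is not free in $B$ or in any assumption (of that proof of $B$) save $A$. Formulae are identified up to renaming of bound variables. An IFOL-proof of $B$ from $A_1,\ldots,A_m$ is a natural deduction with conclusion $B$ all of whose undischarged assumptions are among $A_1,\ldots,A_m$. **The extension $\mathcal{M}_{\mathrm{IFOL}}$** is $\mathcal{M}$ together with basic types $form$ and $term$; constants $\bot: form$; $\&,\vee,\supset\;: form\to(form\to form)$; $\mathrm{true}: form\to prop$; $\forall,\exists : (term\to form)\to form$; a constant of type $term\to\cdots\to term\to term$ (resp. $term\to\cdots\to term\to form$) for each function (resp. predicate) symbol of the signature, with as many arguments as its arity; and the axioms below. Here $\forall x.A$, $\exists x.A$ abbreviate $\forall(\lambda x.A)$, $\exists(\lambda x.A)$; $A,B,C$ are variables of type $form$, $F$ of type $term\to form$, $x,y$ of type $term$; $[\![A]\!]$ abbreviates $\mathrm{true}(A)$: - ($\&$I) $\bigwedge A\,B.\;[\![A]\!]\Rightarrow([\![B]\!]\Rightarrow[\![A\,\&\,B]\!])$ - ($\&$E) $\bigwedge A\,B.\;[\![A\,\&\,B]\!]\Rightarrow[\![A]\!]$ and $\bigwedge A\,B.\;[\![A\,\&\,B]\!]\Rightarrow[\![B]\!]$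 - ($\vee$I) $\bigwedge A\,B.\;[\![A]\!]\Rightarrow[\![A\vee B]\!]$ and $\bigwedge A\,B.\;[\![B]\!]\Rightarrow[\![A\vee B]\!]$ - ($\vee$E) $\bigwedge A\,B\,C.\;[\![A\vee B]\!]\Rightarrow([\![A]\!]\Rightarrow[\![C]\!])\Rightarrow([\![B]\!]\Rightarrow[\![C]\!])\Rightarrow[\![C]\!]$ - ($\supset$I) $\bigwedge A\,B.\;([\![A]\!]\Rightarrow[\![B]\!])\Rightarrow[\![A\supset B]\!]$ - ($\supset$E) $\bigwedge A\,B.\;[\![A\supset B]\!]\Rightarrow[\![A]\!]\Rightarrow[\![B]\!]$ - ($\bot$E) $\bigwedge A.\;[\![\bot]\!]\Rightarrow[\![A]\!]$ - ($\forall$I) $\bigwedge F.\;(\bigwedge x.\,[\![F(x)]\!])\Rightarrow[\![\forall x.F(x)]\!]$ - ($\forall$E) $\bigwedge F\,y.\;[\![\forall x.F(x)]\!]\Rightarrow[\![F(y)]\!]$ - ($\exists$I) $\bigwedge F\,y.\;[\![F(y)]\!]\Rightarrow[\![\exists x.F(x)]\!]$ - ($\exists$E) $\bigwedge F\,B.\;[\![\exists x.F(x)]\!]\Rightarrow(\bigwedge x.\,[\![F(x)]\!]\Rightarrow[\![B]\!])\Rightarrow[\![B]\!]$ An $\mathcal{M}_{\mathrm{IFOL}}$-proof of $\psi$ from $\phi_1,\ldots,\phi_m$ is a deduction of $\psi$ by the rules of $\mathcal{M}$ and these axioms, with undischarged assumptions among $\phi_1,\ldots,\phi_m$. **Translation.**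 An IFOL formula $A$ is read as the evident term of type $form$ (individual variables being variables of type $term$, propositional variables being variables of type $form$, quantified formulae $\forall x.A$ and $\exists x.A$ being read via $\lambda$-abstraction as the terms $\forall(\lambda x.A)$ and $\exists(\lambda x.A)$ respectively), and $[\![A]\!]$ is the meta-formula $\mathrm{true}(A)$. -}

module Defs where

open import Data.Fin.Base using (Fin; zero; suc)
open import Data.List.Base using (List; []; _∷_; _++_; concatMap; replicate)
open import Data.List.Membership.Propositional using (_∈_; _∉_)
open import Data.List.Relation.Binary.Subset.Propositional using (_⊆_)
open import Data.List.Relation.Unary.Any using (here; there)
open import Data.Nat.Base using (ℕ; zero; suc)
open import Data.Product.Base using (_×_; _,_)
open import Data.Vec.Base using (Vec; []; _∷_)
open import Relation.Binary.PropositionalEquality.Core using (refl)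

-- Both logics use a locally nameless syntax, so that syntactic identity is
-- identity up to renaming of bound variables: bound variables are well-scoped
-- de Bruijn indices (bv), while free variables (fv) carry names drawn from an
-- infinite supply.  Deductions only involve expressions without dangling
-- indices.  The expression that a binder-with-body "x. a" denotes is
-- represented by a nameless body a₀ with x ∉ FV a₀ and a = a₀ [ fv x ]; this
-- is how the rules with an eigenvariable x are rendered.
--
-- In Φ ⊢ φ the undischarged assumptions are among Φ.  An eigenvariable proviso
-- concerns only the assumptions Ψ ⊆ Φ on which the premise actually depends.

record Signature : Set₁ where
  field
    Fun       : Set
    funArity  : Fun → ℕ
    Pred      : Set
    predArity : Pred → ℕ

module IFOL (S : Signature) where
  open Signature S

  data Term (n : ℕ) : Set where
    fv  : ℕ → Term n
    bv  : Fin n → Term n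
    fun : (f : Fun) → Vec (Term n) (funArity f) → Term n

  infixr 7 _&_
  infixr 6 _∨_
  infixr 5 _⊃_

  data Formula (n : ℕ) : Set where
    pred        : (p : Pred) → Vec (Term n) (predArity p) → Formula n
    pvar        : ℕ → Formula n
    ⊥           : Formula n
    _&_ _∨_ _⊃_ : Formula n → Formula n → Formula n
    ∀' ∃'       : Formula (suc n) → Formula n

  mutual
    renTerm : ∀ {m n} → (Fin m → Fin n) → Term m → Term n
    renTerm ρ (fv x)     = fv x
    renTerm ρ (bv i)     = bv (ρ i)
    renTerm ρ (fun f ts) = fun f (renTerms ρ ts)

    renTerms : ∀ {m n k} → (Fin m → Fin n) → Vec (Term m) k → Vec (Term n) k
    renTerms ρ []       = []
    renTerms ρ (t ∷ ts) = renTerm ρ t ∷ renTerms ρ ts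

  lift : ∀ {m n} → (Fin m → Term n) → Fin (suc m) → Term (suc n)
  lift s zero    = bv zero
  lift s (suc i) = renTerm suc (s i)

  mutual
    subTerm : ∀ {m n} → (Fin m → Term n) → Term m → Term n
    subTerm s (fv x)     = fv x
    subTerm s (bv i)     = s i
    subTerm s (fun f ts) = fun f (subTerms s ts)

    subTerms : ∀ {m n k} → (Fin m → Term n) → Vec (Term m) k → Vec (Term n) k
    subTerms s []       = []
    subTerms s (t ∷ ts) = subTerm s t ∷ subTerms s ts

  sub : ∀ {m n} → (Fin m → Term n) → Formula m → Formula n
  sub s (pred p ts) = pred p (subTerms s ts)
  sub s (pvar P)    = pvar P
  sub s ⊥           = ⊥
  sub s (A & B)     = sub s A & sub s B
  sub s (A ∨ B)     = sub s A ∨ sub s B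
  sub s (A ⊃ B)     = sub s A ⊃ sub s B
  sub s (∀' A)      = ∀' (sub (lift s) A)
  sub s (∃' A)      = ∃' (sub (lift s) A)

  single : ∀ {n} → Term n → Fin (suc n) → Term n
  single t zero    = t
  single t (suc i) = bv i

  infix 9 _[_]

  _[_] : ∀ {n} → Formula (suc n) → Term n → Formula n
  A [ t ] = sub (single t) A

  mutual
    fvTerm : ∀ {n} → Term n → List ℕ
    fvTerm (fv x)     = x ∷ []
    fvTerm (bv i)     = []
    fvTerm (fun f ts) = fvTerms ts

    fvTerms : ∀ {n k} → Vec (Term n) k → List ℕ
    fvTerms []       = []
    fvTerms (t ∷ ts) = fvTerm t ++ fvTerms ts

  -- Free individual variables; propositional variables are never bound.
  FV : ∀ {n} → Formula n → List ℕ
  FV (pred p ts) = fvTerms ts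
  FV (pvar P)    = []
  FV ⊥           = []
  FV (A & B)     = FV A ++ FV B
  FV (A ∨ B)     = FV A ++ FV B
  FV (A ⊃ B)     = FV A ++ FV B
  FV (∀' A)      = FV A
  FV (∃' A)      = FV A

  infix 3 _⊢_

  data _⊢_ (Γ : List (Formula 0)) : Formula 0 → Set where
    hyp : ∀ {A} → A ∈ Γ → Γ ⊢ A
    &I  : ∀ {A B} → Γ ⊢ A → Γ ⊢ B → Γ ⊢ A & B
    &E₁ : ∀ {A B} → Γ ⊢ A & B → Γ ⊢ A
    &E₂ : ∀ {A B} → Γ ⊢ A & B → Γ ⊢ B
    ∨I₁ : ∀ {A B} → Γ ⊢ A → Γ ⊢ A ∨ B
    ∨I₂ : ∀ {A B} → Γ ⊢ B → Γ ⊢ A ∨ B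
    ∨E  : ∀ {A B C} → Γ ⊢ A ∨ B → A ∷ Γ ⊢ C → B ∷ Γ ⊢ C → Γ ⊢ C
    ⊃I  : ∀ {A B} → A ∷ Γ ⊢ B → Γ ⊢ A ⊃ B
    ⊃E  : ∀ {A B} → Γ ⊢ A ⊃ B → Γ ⊢ A → Γ ⊢ B
    ⊥E  : ∀ {A} → Γ ⊢ ⊥ → Γ ⊢ A
    ∀I  : ∀ {Δ A} (x : ℕ) → Δ ⊆ Γ → x ∉ concatMap FV Δ → x ∉ FV A →
          Δ ⊢ A [ fv x ] → Γ ⊢ ∀' A
    ∀E  : ∀ {A} (t : Term 0) → Γ ⊢ ∀' A → Γ ⊢ A [ t ]
    ∃I  : ∀ {A} (t : Term 0) → Γ ⊢ A [ t ] → Γ ⊢ ∃' A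
    ∃E  : ∀ {Δ A B} (x : ℕ) → Δ ⊆ Γ → x ∉ concatMap FV Δ → x ∉ FV A → x ∉ FV B →
          Γ ⊢ ∃' A → A [ fv x ] ∷ Δ ⊢ B → Γ ⊢ B

infixr 5 _⇒_

data Ty (Base : Set) : Set where
  prop : Ty Base
  base : Base → Ty Base
  _⇒_  : Ty Base → Ty Base → Ty Base

-- The meta-logic over given basic types (besides prop) and non-logical constants.
module Meta (Base : Set) (Const : Ty Base → Set) where

  Type : Set
  Type = Ty Base

  Ctx : Set
  Ctx = List Type

  infixl 8 _·_

  data Tm (Γ : Ctx) : Type → Set where
    con    : ∀ {σ} → Const σ → Tm Γ σ
    imp    : Tm Γ (prop ⇒ prop ⇒ prop)
    forAll : ∀ σ → Tm Γ ((σ ⇒ prop) ⇒ prop)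
    eq     : ∀ σ → Tm Γ (σ ⇒ σ ⇒ prop)
    fv     : ∀ σ → ℕ → Tm Γ σ
    bv     : ∀ {σ} → σ ∈ Γ → Tm Γ σ
    lam    : ∀ {σ τ} → Tm (σ ∷ Γ) τ → Tm Γ (σ ⇒ τ)
    _·_    : ∀ {σ τ} → Tm Γ (σ ⇒ τ) → Tm Γ σ → Tm Γ τ

  infixr 4 _⟹_
  infix  5 _≐_

  _⟹_ : ∀ {Γ} → Tm Γ prop → Tm Γ prop → Tm Γ prop
  φ ⟹ ψ = imp · φ · ψ

  ⋀ : ∀ {Γ} σ → Tm (σ ∷ Γ) prop → Tm Γ prop
  ⋀ σ φ = forAll σ · lam φ

  _≐_ : ∀ {Γ σ} → Tm Γ σ → Tm Γ σ → Tm Γ prop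
  _≐_ {σ = σ} a b = eq σ · a · b

  Ren : Ctx → Ctx → Set
  Ren Γ Δ = ∀ {σ} → σ ∈ Γ → σ ∈ Δ

  liftRen : ∀ {Γ Δ σ} → Ren Γ Δ → Ren (σ ∷ Γ) (σ ∷ Δ)
  liftRen ρ (here p)  = here p
  liftRen ρ (there i) = there (ρ i)

  ren : ∀ {Γ Δ σ} → Ren Γ Δ → Tm Γ σ → Tm Δ σ
  ren ρ (con c)    = con c
  ren ρ imp        = imp
  ren ρ (forAll σ) = forAll σ
  ren ρ (eq σ)     = eq σ
  ren ρ (fv σ x)   = fv σ x
  ren ρ (bv i)     = bv (ρ i)
  ren ρ (lam a)    = lam (ren (liftRen ρ) a)
  ren ρ (a · b)    = ren ρ a · ren ρ b

  Sub : Ctx → Ctx → Set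
  Sub Γ Δ = ∀ {σ} → σ ∈ Γ → Tm Δ σ

  lift : ∀ {Γ Δ σ} → Sub Γ Δ → Sub (σ ∷ Γ) (σ ∷ Δ)
  lift s (here p)  = bv (here p)
  lift s (there i) = ren there (s i)

  sub : ∀ {Γ Δ σ} → Sub Γ Δ → Tm Γ σ → Tm Δ σ
  sub s (con c)    = con c
  sub s imp        = imp
  sub s (forAll σ) = forAll σ
  sub s (eq σ)     = eq σ
  sub s (fv σ x)   = fv σ x
  sub s (bv i)     = s i
  sub s (lam a)    = lam (sub (lift s) a)
  sub s (a · b)    = sub s a · sub s b

  single : ∀ {Γ σ} → Tm Γ σ → Sub (σ ∷ Γ) Γ
  single b (here refl) = b
  single b (there i)   = bv i

  infix 9 _[_]

  _[_] : ∀ {Γ σ τ} → Tm (σ ∷ Γ) τ → Tm Γ σ → Tm Γ τ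
  a [ b ] = sub (single b) a

  FV : ∀ {Γ σ} → Tm Γ σ → List (Type × ℕ)
  FV (con c)    = []
  FV imp        = []
  FV (forAll σ) = []
  FV (eq σ)     = []
  FV (fv σ x)   = (σ , x) ∷ []
  FV (bv i)     = []
  FV (lam a)    = FV a
  FV (a · b)    = FV a ++ FV b

  -- The rule (λx.a) ≡ (λy.a[y/x]) is an instance of ≐refl, since both sides are
  -- the same nameless term.
  module Deduction (Axiom : Tm [] prop → Set) where

    infix 3 _⊢_

    data _⊢_ (Φ : List (Tm [] prop)) : Tm [] prop → Set where
      hyp    : ∀ {φ} → φ ∈ Φ → Φ ⊢ φ
      axiom  : ∀ {φ} → Axiom φ → Φ ⊢ φ
      ⟹I     : ∀ {φ ψ} → φ ∷ Φ ⊢ ψ → Φ ⊢ φ ⟹ ψ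
      ⟹E     : ∀ {φ ψ} → Φ ⊢ φ ⟹ ψ → Φ ⊢ φ → Φ ⊢ ψ
      ⋀I     : ∀ {Ψ σ φ} (x : ℕ) → Ψ ⊆ Φ → (σ , x) ∉ concatMap FV Ψ → (σ , x) ∉ FV φ →
               Ψ ⊢ φ [ fv σ x ] → Φ ⊢ ⋀ σ φ
      ⋀E     : ∀ {σ φ} (b : Tm [] σ) → Φ ⊢ ⋀ σ φ → Φ ⊢ φ [ b ]
      ≐refl  : ∀ {σ} {a : Tm [] σ} → Φ ⊢ a ≐ a
      ≐sym   : ∀ {σ} {a b : Tm [] σ} → Φ ⊢ a ≐ b → Φ ⊢ b ≐ a
      ≐trans : ∀ {σ} {a b c : Tm [] σ} → Φ ⊢ a ≐ b → Φ ⊢ b ≐ c → Φ ⊢ a ≐ c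
      beta   : ∀ {σ τ} {a : Tm (σ ∷ []) τ} {b : Tm [] σ} → Φ ⊢ lam a · b ≐ a [ b ]
      ext    : ∀ {Ψ σ τ} {f g : Tm [] (σ ⇒ τ)} (x : ℕ) → Ψ ⊆ Φ →
               (σ , x) ∉ concatMap FV Ψ → (σ , x) ∉ FV f → (σ , x) ∉ FV g →
               Ψ ⊢ f · fv σ x ≐ g · fv σ x → Φ ⊢ f ≐ g
      abs    : ∀ {Ψ σ τ} {a b : Tm (σ ∷ []) τ} (x : ℕ) → Ψ ⊆ Φ →
               (σ , x) ∉ concatMap FV Ψ → (σ , x) ∉ FV a → (σ , x) ∉ FV b →
               Ψ ⊢ a [ fv σ x ] ≐ b [ fv σ x ] → Φ ⊢ lam a ≐ lam b
      comb   : ∀ {σ τ} {f g : Tm [] (σ ⇒ τ)} {a b : Tm [] σ} →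
               Φ ⊢ f ≐ g → Φ ⊢ a ≐ b → Φ ⊢ f · a ≐ g · b
      ≐I     : ∀ {φ ψ} → φ ∷ Φ ⊢ ψ → ψ ∷ Φ ⊢ φ → Φ ⊢ φ ≐ ψ
      ≐E     : ∀ {φ ψ} → Φ ⊢ φ ≐ ψ → Φ ⊢ φ → Φ ⊢ ψ

data IFOLBase : Set where
  form term : IFOLBase

pattern `form = base form
pattern `term = base term

infixr 5 _⟶_

-- term → ⋯ → term → τ with the given number of arguments
_⟶_ : ℕ → Ty IFOLBase → Ty IFOLBase
zero  ⟶ τ = τ
suc k ⟶ τ = `term ⇒ (k ⟶ τ)

module M-IFOL (S : Signature) where
  open Signature S

  data Const : Ty IFOLBase → Set where
    ⊥c       : Const `form
    &c ∨c ⊃c : Const (`form ⇒ `form ⇒ `form)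
    truec    : Const (`form ⇒ prop)
    ∀c ∃c    : Const ((`term ⇒ `form) ⇒ `form)
    func     : (f : Fun) → Const (funArity f ⟶ `term)
    predc    : (p : Pred) → Const (predArity p ⟶ `form)

  open Meta IFOLBase Const public

  module _ {Γ : Ctx} where

    infixr 7 _&ᵐ_
    infixr 6 _∨ᵐ_
    infixr 5 _⊃ᵐ_

    ⊥ᵐ : Tm Γ `form
    ⊥ᵐ = con ⊥c

    _&ᵐ_ _∨ᵐ_ _⊃ᵐ_ : Tm Γ `form → Tm Γ `form → Tm Γ `form
    A &ᵐ B = con &c · A · B
    A ∨ᵐ B = con ∨c · A · B
    A ⊃ᵐ B = con ⊃c · A · B

    ∀ᵐ ∃ᵐ : Tm (`term ∷ Γ) `form → Tm Γ `form
    ∀ᵐ A = con ∀c · lam A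
    ∃ᵐ A = con ∃c · lam A

    ⟦_⟧ : Tm Γ `form → Tm Γ prop
    ⟦ A ⟧ = con truec · A

  private
    #0 : ∀ {Γ σ} → Tm (σ ∷ Γ) σ
    #0 = bv (here refl)

    #1 : ∀ {Γ σ τ} → Tm (τ ∷ σ ∷ Γ) σ
    #1 = bv (there (here refl))

    #2 : ∀ {Γ σ τ υ} → Tm (υ ∷ τ ∷ σ ∷ Γ) σ
    #2 = bv (there (there (here refl)))

  data Axiom : Tm [] prop → Set where
    &I  : Axiom (⋀ `form (⋀ `form (⟦ #1 ⟧ ⟹ ⟦ #0 ⟧ ⟹ ⟦ #1 &ᵐ #0 ⟧)))
    &E₁ : Axiom (⋀ `form (⋀ `form (⟦ #1 &ᵐ #0 ⟧ ⟹ ⟦ #1 ⟧)))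
    &E₂ : Axiom (⋀ `form (⋀ `form (⟦ #1 &ᵐ #0 ⟧ ⟹ ⟦ #0 ⟧)))
    ∨I₁ : Axiom (⋀ `form (⋀ `form (⟦ #1 ⟧ ⟹ ⟦ #1 ∨ᵐ #0 ⟧)))
    ∨I₂ : Axiom (⋀ `form (⋀ `form (⟦ #0 ⟧ ⟹ ⟦ #1 ∨ᵐ #0 ⟧)))
    ∨E  : Axiom (⋀ `form (⋀ `form (⋀ `form
            (⟦ #2 ∨ᵐ #1 ⟧ ⟹ (⟦ #2 ⟧ ⟹ ⟦ #0 ⟧) ⟹ (⟦ #1 ⟧ ⟹ ⟦ #0 ⟧) ⟹ ⟦ #0 ⟧))))
    ⊃I  : Axiom (⋀ `form (⋀ `form ((⟦ #1 ⟧ ⟹ ⟦ #0 ⟧) ⟹ ⟦ #1 ⊃ᵐ #0 ⟧)))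
    ⊃E  : Axiom (⋀ `form (⋀ `form (⟦ #1 ⊃ᵐ #0 ⟧ ⟹ ⟦ #1 ⟧ ⟹ ⟦ #0 ⟧)))
    ⊥E  : Axiom (⋀ `form (⟦ ⊥ᵐ ⟧ ⟹ ⟦ #0 ⟧))
    ∀I  : Axiom (⋀ (`term ⇒ `form) (⋀ `term ⟦ #1 · #0 ⟧ ⟹ ⟦ ∀ᵐ (#1 · #0) ⟧))
    ∀E  : Axiom (⋀ (`term ⇒ `form) (⋀ `term (⟦ ∀ᵐ (#2 · #0) ⟧ ⟹ ⟦ #1 · #0 ⟧)))
    ∃I  : Axiom (⋀ (`term ⇒ `form) (⋀ `term (⟦ #1 · #0 ⟧ ⟹ ⟦ ∃ᵐ (#2 · #0) ⟧)))
    ∃E  : Axiom (⋀ (`term ⇒ `form) (⋀ `form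
            (⟦ ∃ᵐ (#2 · #0) ⟧ ⟹ ⋀ `term (⟦ #2 · #0 ⟧ ⟹ ⟦ #1 ⟧) ⟹ ⟦ #0 ⟧)))

  open Deduction Axiom public

module Translation (S : Signature) where
  open IFOL S using (Term; Formula; fv; bv; fun; pred; pvar; ⊥; _&_; _∨_; _⊃_; ∀'; ∃')
  open M-IFOL S hiding (fv; bv)
  private module M = M-IFOL S

  terms : ℕ → Ctx
  terms n = replicate n `term

  ⌜_⌝ᵛ : ∀ {n} → Fin n → `term ∈ terms n
  ⌜ zero ⌝ᵛ  = here refl
  ⌜ suc i ⌝ᵛ = there ⌜ i ⌝ᵛ

  mutual
    ⌜_⌝ᵗ : ∀ {n} → Term n → Tm (terms n) `term
    ⌜ fv x ⌝ᵗ     = M.fv `term x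
    ⌜ bv i ⌝ᵗ     = M.bv ⌜ i ⌝ᵛ
    ⌜ fun f ts ⌝ᵗ = apply (con (func f)) ts

    -- Application to the translations of the arguments.
    apply : ∀ {n k τ} → Tm (terms n) (k ⟶ τ) → Vec (Term n) k → Tm (terms n) τ
    apply a []       = a
    apply a (t ∷ ts) = apply (a · ⌜ t ⌝ᵗ) ts

  ⌜_⌝ : ∀ {n} → Formula n → Tm (terms n) `form
  ⌜ pred p ts ⌝ = apply (con (predc p)) ts
  ⌜ pvar P ⌝    = M.fv `form P
  ⌜ ⊥ ⌝         = ⊥ᵐ
  ⌜ A & B ⌝     = ⌜ A ⌝ &ᵐ ⌜ B ⌝
  ⌜ A ∨ B ⌝     = ⌜ A ⌝ ∨ᵐ ⌜ B ⌝
  ⌜ A ⊃ B ⌝     = ⌜ A ⌝ ⊃ᵐ ⌜ B ⌝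
  ⌜ ∀' A ⌝      = ∀ᵐ ⌜ A ⌝
  ⌜ ∃' A ⌝      = ∃ᵐ ⌜ A ⌝

  ⟪_⟫ : Formula 0 → Tm [] prop
  ⟪ A ⟫ = ⟦ ⌜ A ⌝ ⟧

{-# OPTIONS --safe #-}

-- Each rule of IFOL is simulated by the corresponding axiom of M-IFOL: the
-- translation commutes with substitution and creates no free variables of type
-- term, so the eigenvariable provisos carry over to ⋀I.  Only the quantifiers
-- need λ-conversion: an axiom instantiated at F speaks of F(t) and of
-- ∀(λx. F(x)), whereas for F = λx.A the translation gives A[t/x] (by β) and
-- ∀F (by η, which extensionality yields).
module Submission where

open import Defs
open import Data.Fin.Base using (Fin; zero; suc)
open import Data.List.Base using (List; []; _∷_; _++_; concatMap; map)
open import Data.List.Extrema.Nat using (max; xs≤max)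
open import Data.List.Membership.Propositional using (_∈_; _∉_)
open import Data.List.Membership.Propositional.Properties
  using (∈-map⁺; ∈-++⁺ˡ; ∈-++⁺ʳ; ∈-++⁻; ∈-concatMap⁺; ∈-concatMap⁻)
open import Data.List.Relation.Binary.Subset.Propositional.Properties using (map⁺)
open import Data.List.Relation.Unary.All using (lookup)
import Data.List.Relation.Unary.Any as Any
import Data.List.Relation.Unary.Any.Properties as Any
open import Data.List.Relation.Unary.Any using (here; there)
open import Data.Nat.Base using (suc)
open import Data.Nat.Properties using (1+n≰n)
open import Data.Product.Base using (_,_; proj₂; ∃-syntax)
open import Data.Sum.Base using (_⊎_; inj₁; inj₂; [_,_]′)
import Data.Sum.Base as Sum
open import Data.Vec.Base using (Vec; []; _∷_)
open import Function.Base using (_∘_; id)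
open import Relation.Binary.PropositionalEquality
  using (_≡_; refl; sym; trans; cong; cong₂; subst)

∈-++-map : ∀ {A B : Set} {x : A} {y : B} (xs : List A) {ys : List A} {us vs : List B} →
           (x ∈ xs → y ∈ us) → (x ∈ ys → y ∈ vs) → x ∈ xs ++ ys → y ∈ us ++ vs
∈-++-map xs {us = us} f g = [ ∈-++⁺ˡ ∘ f , ∈-++⁺ʳ us ∘ g ]′ ∘ ∈-++⁻ xs

-- Weakening, freshness and η in the meta-logic.

module MetaProperties (Base : Set) (Const : Ty Base → Set) where
  open Meta Base Const

  fresh : ∀ {Γ σ} (a : Tm Γ σ) → ∃[ x ] (∀ τ → (τ , x) ∉ FV a)
  -- Types are discarded before taking the maximum, so the successor is fresh at all types at once.
  fresh a = suc m , λ τ i → 1+n≰n (lookup (xs≤max 0 xs) (∈-map⁺ proj₂ i))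
    where
    xs = map proj₂ (FV a)
    m  = max 0 xs

  FV-ren : ∀ {Γ Δ σ} (ρ : Ren Γ Δ) (a : Tm Γ σ) → FV (ren ρ a) ≡ FV a
  FV-ren ρ (con c)    = refl
  FV-ren ρ imp        = refl
  FV-ren ρ (forAll σ) = refl
  FV-ren ρ (eq σ)     = refl
  FV-ren ρ (fv σ x)   = refl
  FV-ren ρ (bv i)     = refl
  FV-ren ρ (lam a)    = FV-ren (liftRen ρ) a
  FV-ren ρ (a · b)    = cong₂ _++_ (FV-ren ρ a) (FV-ren ρ b)

  -- The hypothesis concerns variables only and `ρ`, `s` are arbitrary, so that the induction passes
  -- under `lam`, where both get lifted.
  sub-ren-id : ∀ {Γ Δ σ} {ρ : Ren Γ Δ} {s : Sub Δ Γ} →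
               (∀ {τ} (i : τ ∈ Γ) → s (ρ i) ≡ bv i) →
               (a : Tm Γ σ) → sub s (ren ρ a) ≡ a
  sub-ren-id h (con c)    = refl
  sub-ren-id h imp        = refl
  sub-ren-id h (forAll σ) = refl
  sub-ren-id h (eq σ)     = refl
  sub-ren-id h (fv σ x)   = refl
  sub-ren-id h (bv i)     = h i
  sub-ren-id h (lam a)    =
    cong lam (sub-ren-id (λ { (here p) → refl ; (there i) → cong (ren there) (h i) }) a)
  sub-ren-id h (a · b)    = cong₂ _·_ (sub-ren-id h a) (sub-ren-id h b)

  -- Serves axioms with nested binders: a term instantiated for an outer variable is weakened twice,
  -- and the next instantiation, lifted under the inner binder, undoes only one of the two
  -- weakenings.
  sub-ren-ren : ∀ {Γ Δ Θ Ξ σ} {ρ : Ren Γ Δ} {ρ′ : Ren Δ Θ} {s : Sub Θ Ξ} {ρ″ : Ren Γ Ξ} →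
                (∀ {τ} (i : τ ∈ Γ) → s (ρ′ (ρ i)) ≡ bv (ρ″ i)) →
                (a : Tm Γ σ) → sub s (ren ρ′ (ren ρ a)) ≡ ren ρ″ a
  sub-ren-ren h (con c)    = refl
  sub-ren-ren h imp        = refl
  sub-ren-ren h (forAll σ) = refl
  sub-ren-ren h (eq σ)     = refl
  sub-ren-ren h (fv σ x)   = refl
  sub-ren-ren h (bv i)     = h i
  sub-ren-ren h (lam a)    =
    cong lam (sub-ren-ren (λ { (here p) → refl ; (there i) → cong (ren there) (h i) }) a)
  sub-ren-ren h (a · b)    = cong₂ _·_ (sub-ren-ren h a) (sub-ren-ren h b)

  single-wk : ∀ {Γ σ τ} (a : Tm Γ σ) (b : Tm Γ τ) → sub (single b) (ren there a) ≡ a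
  single-wk a b = sub-ren-id (λ _ → refl) a

  lift-single-wk : ∀ {Γ σ τ υ} (a : Tm Γ σ) (b : Tm Γ τ) →
                   sub (lift {σ = υ} (single b)) (ren there (ren there a)) ≡ ren there a
  lift-single-wk a b = sub-ren-ren (λ _ → refl) a

  wk-∉ : ∀ {Γ σ υ v} (a : Tm Γ σ) → v ∉ FV a → v ∉ FV (ren {Δ = υ ∷ Γ} there a)
  wk-∉ a v∉a = v∉a ∘ subst (_ ∈_) (FV-ren there a)

  wk·-∉ : ∀ {Γ σ τ v} (f : Tm Γ (σ ⇒ τ)) → v ∉ FV f → v ∉ FV (ren there f · bv (here refl))
  wk·-∉ f v∉f = [ wk-∉ f v∉f , (λ ()) ]′ ∘ ∈-++⁻ (FV (ren there f))

  module _ {Axiom : Tm [] prop → Set} where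
    open Deduction Axiom

    eta : ∀ {Φ σ τ} (f : Tm [] (σ ⇒ τ)) → Φ ⊢ lam (ren there f · bv (here refl)) ≐ f
    eta {σ = σ} f with x , x∉f ← fresh f =
      -- `ext` is used with no assumptions at all, so `x` has to avoid only `f`.
      ext x (λ ()) (λ ()) (wk·-∉ f (x∉f σ)) (x∉f σ)
        (subst (λ g → [] ⊢ lam (ren there f · bv (here refl)) · fv σ x ≐ g · fv σ x)
          (single-wk f (fv σ x)) beta)

    rewriteʳ : ∀ {Φ σ} (p : Tm [] (σ ⇒ prop)) {a b} → Φ ⊢ a ≐ b → Φ ⊢ p · a → Φ ⊢ p · b
    rewriteʳ p a≐b = ≐E (comb ≐refl a≐b)

module Completeness (S : Signature) where
  module I = IFOL S
  open I using (Term; Formula; fv; bv; fun; pred; pvar; ⊥; _&_; _∨_; _⊃_; ∀'; ∃')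
  open Translation S
  module M = M-IFOL S
  open M using (Tm; FV; con; lam; _·_; _⊢_; _⟹_; ⋀; ⟦_⟧; _&ᵐ_; _∨ᵐ_; _⊃ᵐ_; ⊥ᵐ;
                truec; ∀c; ∃c; axiom; ⟹I; ⟹E; ⋀I; ⋀E; beta; ≐E; ≐sym; comb; ≐refl)
  open MetaProperties IFOLBase M.Const

  -- Translation commutes with renaming and substitution.

  mutual
    -- Needed for terms only: lifting a substitution under a quantifier weakens the terms that it
    -- assigns.
    translate-renTerm : ∀ {m n} {ρ : Fin m → Fin n} {ρ′ : M.Ren (terms m) (terms n)} →
                        (∀ i → ρ′ ⌜ i ⌝ᵛ ≡ ⌜ ρ i ⌝ᵛ) →
                        (t : Term m) → ⌜ I.renTerm ρ t ⌝ᵗ ≡ M.ren ρ′ ⌜ t ⌝ᵗ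
    translate-renTerm h (fv x)     = refl
    translate-renTerm h (bv i)     = cong M.bv (sym (h i))
    translate-renTerm h (fun f ts) = apply-ren h refl ts

    -- `apply` accumulates arguments in its head, so the induction on `ts` must allow any pair of
    -- heads already known to correspond.
    apply-ren : ∀ {m n k τ} {ρ : Fin m → Fin n} {ρ′ : M.Ren (terms m) (terms n)} →
                (∀ i → ρ′ ⌜ i ⌝ᵛ ≡ ⌜ ρ i ⌝ᵛ) →
                {a : Tm (terms n) (k ⟶ τ)} {b : Tm (terms m) (k ⟶ τ)} → a ≡ M.ren ρ′ b →
                (ts : Vec (Term m) k) → apply a (I.renTerms ρ ts) ≡ M.ren ρ′ (apply b ts)
    apply-ren h e []       = e
    apply-ren h e (t ∷ ts) = apply-ren h (cong₂ _·_ e (translate-renTerm h t)) ts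

  _≗ˢ_ : ∀ {m n} → M.Sub (terms m) (terms n) → (Fin m → Term n) → Set
  s′ ≗ˢ s = ∀ i → s′ ⌜ i ⌝ᵛ ≡ ⌜ s i ⌝ᵗ

  lift-≗ˢ : ∀ {m n} {s′ : M.Sub (terms m) (terms n)} {s : Fin m → Term n} →
            s′ ≗ˢ s → M.lift s′ ≗ˢ I.lift s
  lift-≗ˢ h zero            = refl
  lift-≗ˢ {s = s} h (suc i) =
    trans (cong (M.ren there) (h i)) (sym (translate-renTerm (λ _ → refl) (s i)))

  mutual
    translate-subTerm : ∀ {m n} {s′ : M.Sub (terms m) (terms n)} {s : Fin m → Term n} →
                        s′ ≗ˢ s → (t : Term m) → ⌜ I.subTerm s t ⌝ᵗ ≡ M.sub s′ ⌜ t ⌝ᵗ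
    translate-subTerm h (fv x)     = refl
    translate-subTerm h (bv i)     = sym (h i)
    translate-subTerm h (fun f ts) = apply-sub h refl ts

    apply-sub : ∀ {m n k τ} {s′ : M.Sub (terms m) (terms n)} {s : Fin m → Term n} → s′ ≗ˢ s →
                {a : Tm (terms n) (k ⟶ τ)} {b : Tm (terms m) (k ⟶ τ)} → a ≡ M.sub s′ b →
                (ts : Vec (Term m) k) → apply a (I.subTerms s ts) ≡ M.sub s′ (apply b ts)
    apply-sub h e []       = e
    apply-sub h e (t ∷ ts) = apply-sub h (cong₂ _·_ e (translate-subTerm h t)) ts

  translate-sub : ∀ {m n} {s′ : M.Sub (terms m) (terms n)} {s : Fin m → Term n} →
                  s′ ≗ˢ s → (A : Formula m) → ⌜ I.sub s A ⌝ ≡ M.sub s′ ⌜ A ⌝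
  translate-sub h (pred p ts) = apply-sub h refl ts
  translate-sub h (pvar P)    = refl
  translate-sub h ⊥           = refl
  translate-sub h (A & B)     = cong₂ _&ᵐ_ (translate-sub h A) (translate-sub h B)
  translate-sub h (A ∨ B)     = cong₂ _∨ᵐ_ (translate-sub h A) (translate-sub h B)
  translate-sub h (A ⊃ B)     = cong₂ _⊃ᵐ_ (translate-sub h A) (translate-sub h B)
  translate-sub h (∀' A)      = cong M.∀ᵐ (translate-sub (lift-≗ˢ h) A)
  translate-sub h (∃' A)      = cong M.∃ᵐ (translate-sub (lift-≗ˢ h) A)

  translate-[] : ∀ {n} (A : Formula (suc n)) (t : Term n) →
                 ⌜ A I.[ t ] ⌝ ≡ ⌜ A ⌝ M.[ ⌜ t ⌝ᵗ ]
  translate-[] A t = translate-sub (λ { zero → refl ; (suc i) → refl }) A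

  -- Free variables of translations.

  mutual
    FV-translateᵗ : ∀ {n x} (t : Term n) → (`term , x) ∈ FV ⌜ t ⌝ᵗ → x ∈ I.fvTerm t
    FV-translateᵗ (fv x)     (here refl) = here refl
    FV-translateᵗ (fun f ts) i           = [ (λ ()) , id ]′ (FV-apply (con (M.func f)) ts i)

    -- The left alternative collects what the accumulating head contributes; it is empty when the
    -- head is a constant.
    FV-apply : ∀ {n k τ x} (a : Tm (terms n) (k ⟶ τ)) (ts : Vec (Term n) k) →
               (`term , x) ∈ FV (apply a ts) → (`term , x) ∈ FV a ⊎ x ∈ I.fvTerms ts
    FV-apply a []       i = inj₁ i
    FV-apply a (t ∷ ts) i with FV-apply (a · ⌜ t ⌝ᵗ) ts i
    ... | inj₁ j = Sum.map₂ (∈-++⁺ˡ ∘ FV-translateᵗ t) (∈-++⁻ (FV a) j)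
    ... | inj₂ j = inj₂ (∈-++⁺ʳ (I.fvTerm t) j)

  -- The restriction to type `term` matters: `pvar P` becomes a free variable of type `form`, which
  -- `I.FV` does not list and which the types keep apart from an individual variable of the same
  -- number.
  FV-translate : ∀ {n x} (A : Formula n) → (`term , x) ∈ FV ⌜ A ⌝ → x ∈ I.FV A
  FV-translate (pred p ts) = [ (λ ()) , id ]′ ∘ FV-apply (con (M.predc p)) ts
  FV-translate (pvar P)    = λ { (here ()) ; (there ()) }
  FV-translate ⊥           = λ ()
  FV-translate (A & B)     = ∈-++-map (FV ⌜ A ⌝) (FV-translate A) (FV-translate B)
  FV-translate (A ∨ B)     = ∈-++-map (FV ⌜ A ⌝) (FV-translate A) (FV-translate B)
  FV-translate (A ⊃ B)     = ∈-++-map (FV ⌜ A ⌝) (FV-translate A) (FV-translate B)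
  FV-translate (∀' A)      = FV-translate A
  FV-translate (∃' A)      = FV-translate A

  FV-assumptions : ∀ {x} (As : List (Formula 0)) →
                   (`term , x) ∈ concatMap FV (map ⟪_⟫ As) → x ∈ concatMap I.FV As
  FV-assumptions As =
    ∈-concatMap⁺ I.FV ∘ Any.map (λ {A} → FV-translate A) ∘ Any.map⁻
      ∘ ∈-concatMap⁻ FV {xs = map ⟪_⟫ As}

  -- The axioms as derived rules.

  module _ {Φ : List (Tm [] prop)} where

    -- Instantiating the outer `⋀` leaves `A` weakened under the inner one; `single-wk` cancels this
    -- after the second instantiation, here and in the other two-variable propositional rules.
    &Iᵐ : ∀ {A B} → Φ ⊢ ⟦ A ⟧ → Φ ⊢ ⟦ B ⟧ → Φ ⊢ ⟦ A &ᵐ B ⟧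
    &Iᵐ {A} {B} p q with r ← ⋀E B (⋀E A (axiom M.&I)) rewrite single-wk A B = ⟹E (⟹E r p) q

    &E₁ᵐ : ∀ {A B} → Φ ⊢ ⟦ A &ᵐ B ⟧ → Φ ⊢ ⟦ A ⟧
    &E₁ᵐ {A} {B} p with r ← ⋀E B (⋀E A (axiom M.&E₁)) rewrite single-wk A B = ⟹E r p

    &E₂ᵐ : ∀ {A B} → Φ ⊢ ⟦ A &ᵐ B ⟧ → Φ ⊢ ⟦ B ⟧
    &E₂ᵐ {A} {B} p with r ← ⋀E B (⋀E A (axiom M.&E₂)) rewrite single-wk A B = ⟹E r p

    ∨I₁ᵐ : ∀ {A B} → Φ ⊢ ⟦ A ⟧ → Φ ⊢ ⟦ A ∨ᵐ B ⟧
    ∨I₁ᵐ {A} {B} p with r ← ⋀E B (⋀E A (axiom M.∨I₁)) rewrite single-wk A B = ⟹E r p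

    ∨I₂ᵐ : ∀ {A B} → Φ ⊢ ⟦ B ⟧ → Φ ⊢ ⟦ A ∨ᵐ B ⟧
    ∨I₂ᵐ {A} {B} p with r ← ⋀E B (⋀E A (axiom M.∨I₂)) rewrite single-wk A B = ⟹E r p

    ∨Eᵐ : ∀ {A B C} → Φ ⊢ ⟦ A ∨ᵐ B ⟧ → ⟦ A ⟧ ∷ Φ ⊢ ⟦ C ⟧ → ⟦ B ⟧ ∷ Φ ⊢ ⟦ C ⟧ → Φ ⊢ ⟦ C ⟧
    ∨Eᵐ {A} {B} {C} p q q′
      with r ← ⋀E C (⋀E B (⋀E A (axiom M.∨E)))
      -- `A` starts under two further binders: instantiating with `B` removes one weakening, with
      -- `C` the other.
      rewrite lift-single-wk {υ = `form} A B | single-wk A C | single-wk B C =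
      ⟹E (⟹E (⟹E r p) (⟹I q)) (⟹I q′)

    ⊃Iᵐ : ∀ {A B} → ⟦ A ⟧ ∷ Φ ⊢ ⟦ B ⟧ → Φ ⊢ ⟦ A ⊃ᵐ B ⟧
    ⊃Iᵐ {A} {B} p with r ← ⋀E B (⋀E A (axiom M.⊃I)) rewrite single-wk A B = ⟹E r (⟹I p)

    ⊃Eᵐ : ∀ {A B} → Φ ⊢ ⟦ A ⊃ᵐ B ⟧ → Φ ⊢ ⟦ A ⟧ → Φ ⊢ ⟦ B ⟧
    ⊃Eᵐ {A} {B} p q with r ← ⋀E B (⋀E A (axiom M.⊃E)) rewrite single-wk A B = ⟹E (⟹E r p) q

    ⊥Eᵐ : ∀ {A} → Φ ⊢ ⟦ ⊥ᵐ ⟧ → Φ ⊢ ⟦ A ⟧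
    ⊥Eᵐ {A} = ⟹E (⋀E A (axiom M.⊥E))

    β-expand : ∀ {A : Tm (`term ∷ []) `form} {t} → Φ ⊢ ⟦ A M.[ t ] ⟧ → Φ ⊢ ⟦ lam A · t ⟧
    β-expand = rewriteʳ (con truec) (≐sym beta)

    β-reduce : ∀ {A : Tm (`term ∷ []) `form} {t} → Φ ⊢ ⟦ lam A · t ⟧ → Φ ⊢ ⟦ A M.[ t ] ⟧
    β-reduce = rewriteʳ (con truec) beta

    η-expand : ∀ {F} (Q : M.Const ((`term ⇒ `form) ⇒ `form)) →
               Φ ⊢ ⟦ con Q · F ⟧ → Φ ⊢ ⟦ con Q · lam (M.ren there F · M.bv (here refl)) ⟧
    η-expand {F} Q = rewriteʳ (con truec) (comb ≐refl (≐sym (eta F)))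

    η-reduce : ∀ {F} (Q : M.Const ((`term ⇒ `form) ⇒ `form)) →
               Φ ⊢ ⟦ con Q · lam (M.ren there F · M.bv (here refl)) ⟧ → Φ ⊢ ⟦ con Q · F ⟧
    η-reduce {F} Q = rewriteʳ (con truec) (comb ≐refl (eta F))

    -- For arbitrary `F` only η is needed, here and in the other quantifier rules; β is left to
    -- `complete`, where `F` is an abstraction.
    ∀Iᵐ : ∀ {F} → Φ ⊢ ⋀ `term ⟦ M.ren there F · M.bv (here refl) ⟧ → Φ ⊢ ⟦ con ∀c · F ⟧
    ∀Iᵐ {F} p = η-reduce ∀c (⟹E (⋀E F (axiom M.∀I)) p)

    ∀Eᵐ : ∀ {F} t → Φ ⊢ ⟦ con ∀c · F ⟧ → Φ ⊢ ⟦ F · t ⟧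
    ∀Eᵐ {F} t p
      with r ← ⋀E t (⋀E F (axiom M.∀E))
      rewrite lift-single-wk {υ = `term} F t | single-wk F t =
      ⟹E r (η-expand ∀c p)

    ∃Iᵐ : ∀ {F} t → Φ ⊢ ⟦ F · t ⟧ → Φ ⊢ ⟦ con ∃c · F ⟧
    ∃Iᵐ {F} t p
      with r ← ⋀E t (⋀E F (axiom M.∃I))
      rewrite lift-single-wk {υ = `term} F t | single-wk F t =
      η-reduce ∃c (⟹E r p)

    ∃Eᵐ : ∀ {F B} → Φ ⊢ ⟦ con ∃c · F ⟧ →
          Φ ⊢ ⋀ `term (⟦ M.ren there F · M.bv (here refl) ⟧ ⟹ ⟦ M.ren there B ⟧) → Φ ⊢ ⟦ B ⟧
    ∃Eᵐ {F} {B} p q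
      with r ← ⋀E B (⋀E F (axiom M.∃E))
      -- `F` occurs only below the λ or the `⋀` over individuals, so `single-wk` is not called for.
      rewrite lift-single-wk {υ = `term} F B =
      ⟹E (⟹E r (η-expand ∃c p)) q

  -- Induction on IFOL deductions.

  complete : ∀ {As B} → As I.⊢ B → map ⟪_⟫ As ⊢ ⟪ B ⟫
  complete (I.hyp i)    = M.hyp (∈-map⁺ ⟪_⟫ i)
  complete (I.&I p q)   = &Iᵐ (complete p) (complete q)
  complete (I.&E₁ p)    = &E₁ᵐ (complete p)
  complete (I.&E₂ p)    = &E₂ᵐ (complete p)
  complete (I.∨I₁ p)    = ∨I₁ᵐ (complete p)
  complete (I.∨I₂ p)    = ∨I₂ᵐ (complete p)
  complete (I.∨E p q r) = ∨Eᵐ (complete p) (complete q) (complete r)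
  complete (I.⊃I p)     = ⊃Iᵐ (complete p)
  complete (I.⊃E p q)   = ⊃Eᵐ (complete p) (complete q)
  complete (I.⊥E p)     = ⊥Eᵐ (complete p)
  complete (I.∀I {Δ} {A} x Δ⊆Γ x∉Δ x∉A p) =
    -- The object-level eigenvariable also serves `⋀I`, with the translation of the same sublist `Δ`
    -- of assumptions.
    ∀Iᵐ (⋀I x (map⁺ ⟪_⟫ Δ⊆Γ) (x∉Δ ∘ FV-assumptions Δ)
      (wk·-∉ (lam ⌜ A ⌝) (x∉A ∘ FV-translate A)) premise)
    where
    premise : map ⟪_⟫ Δ ⊢ ⟦ M.ren there (lam ⌜ A ⌝) · M.bv (here refl) ⟧ M.[ M.fv `term x ]
    premise = subst (λ F → map ⟪_⟫ Δ ⊢ ⟦ F · M.fv `term x ⟧)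
      (sym (single-wk (lam ⌜ A ⌝) (M.fv `term x)))
      (β-expand (subst (λ B → map ⟪_⟫ Δ ⊢ ⟦ B ⟧) (translate-[] A (fv x)) (complete p)))
  complete (I.∀E {A} t p) =
    subst (λ B → _ ⊢ ⟦ B ⟧) (sym (translate-[] A t)) (β-reduce (∀Eᵐ ⌜ t ⌝ᵗ (complete p)))
  complete (I.∃I {A} t p) =
    ∃Iᵐ ⌜ t ⌝ᵗ (β-expand (subst (λ B → _ ⊢ ⟦ B ⟧) (translate-[] A t) (complete p)))
  complete (I.∃E {Δ} {A} {B} x Δ⊆Γ x∉Δ x∉A x∉B p q) =
    ∃Eᵐ (complete p) (⋀I x (map⁺ ⟪_⟫ Δ⊆Γ) (x∉Δ ∘ FV-assumptions Δ) x∉ψ⟹B premise)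
    where
    ψ : Tm (`term ∷ []) prop
    ψ = ⟦ M.ren there (lam ⌜ A ⌝) · M.bv (here refl) ⟧

    -- `B` lies in the scope of the `⋀` being introduced, so the ∃E proviso on `B` turns into
    -- freshness for its body.
    x∉ψ⟹B : (`term , x) ∉ FV (ψ ⟹ ⟦ M.ren there ⌜ B ⌝ ⟧)
    x∉ψ⟹B = [ wk·-∉ (lam ⌜ A ⌝) (x∉A ∘ FV-translate A) , wk-∉ ⌜ B ⌝ (x∉B ∘ FV-translate B) ]′
      ∘ ∈-++⁻ (FV ψ)

    -- β is applied inside the implication, so that no weakening of the
    -- deduction q to the assumption (λx.A)(x) is needed.
    premise : map ⟪_⟫ Δ ⊢ (ψ ⟹ ⟦ M.ren there ⌜ B ⌝ ⟧) M.[ M.fv `term x ]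
    premise rewrite single-wk (lam ⌜ A ⌝) (M.fv `term x) | single-wk ⌜ B ⌝ (M.fv `term x) =
      ≐E (comb (comb ≐refl (comb ≐refl (≐sym beta))) ≐refl)
        (subst (λ C → map ⟪_⟫ Δ ⊢ ⟦ C ⟧ ⟹ ⟪ B ⟫) (translate-[] A (fv x)) (⟹I (complete q)))

theorem5 : (S : Signature) →
    let open IFOL S using (Formula) renaming (_⊢_ to _⊢IFOL_)
        open M-IFOL S using () renaming (_⊢_ to _⊢M_)
        open Translation S using (⟪_⟫)
    in (As : List (Formula 0)) (B : Formula 0) →
       As ⊢IFOL B → map ⟪_⟫ As ⊢M ⟪ B ⟫
theorem5 S As B = Completeness.complete S
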